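{- For $n\ge1$, $$b_n(1;t,1,1)=\sum_{k=0}^{n-1}c(n,k+1)t^k\quad\text{and}\quad b_n(1;1,1,t)=b_n(1;t,t,1)=\sum_{k=0}^{n-1}e(n,k)t^k.$$ That is, the number of inversion sequences of length $n$ with exactly $k$ levels equals $c(n,k+1)$, and the number with exactly $k$ ascents, as well as the number with exactly $k$ indices that are levels or descents, equals $e(n,k)$.
   Context: An inversion sequence of length $n$ is a sequence $\rho=\rho_1\cdots\rho_n$ of integers with $1\le \rho_i\le i$ for all $i$; $I_n$ is the set of them. A level, descent, or ascent of $\rho$ is an index $i\in[n-1]$ with $\rho_i=\rho_{i+1}$, $\rho_i>\rho_{i+1}$, or $\rho_i<\rho_{i+1}$, respectively. Define $b_n(1;p,q,r)=\sum_{\rho\in I_n}p^{\mathrm{lev}(\rho)}q^{\mathrm{des}(\rho)}r^{\mathrm{asc}(\rho)}$. Here $c(n,k)$ is the signless Stirling number of the first kind (number of permutations of $[n]$ with $k$ cycles) and $e(n,k)$ is the Eulerian number (number of permutations of $[n]$ with $k$ ascents). -}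

module Defs where

open import Algebra.Bundles using (CommutativeSemiring)
import Algebra.Properties.Semiring.Exp
import Algebra.Properties.Semiring.Mult
import Algebra.Properties.Semiring.Sum
open import Data.Fin.Base using (Fin; zero; suc; toℕ)
import Data.Fin.Properties as Fin
open import Data.List.Base using (List; [_]; map; foldr; filter; length; zip; drop; upTo; allFin; cartesianProductWith; deduplicate)
open import Data.List.Membership.Propositional using (_∈_)
open import Data.List.Membership.Propositional.Properties using (∈-map⁺; ∈-upTo⁺; ∈-allFin; ∈-filter⁺; ∈-filter⁻; ∈-cartesianProductWith⁺)
open import Data.List.Relation.Unary.Any using (here)
import Data.List.Relation.Unary.AllPairs as ListAllPairs
import Data.List.Relation.Unary.All as ListAll
import Data.List.Relation.Unary.Unique.Propositional as List
import Data.List.Relation.Unary.Unique.Propositional.Properties as ListUnique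
open import Data.Nat.Base using (ℕ; zero; suc; _≤_; _<_; _>_; s≤s)
open import Data.Nat.GeneralisedArithmetic using (iterate)
open import Data.Nat.Properties using (_≟_; _≤?_; _<?_; _>?_; ≤-trans; suc-injective)
open import Data.Product.Base using (_×_; _,_; proj₁; proj₂; ∃; uncurry)
open import Data.Sum.Base using (_⊎_)
open import Data.Vec.Base as Vec using (Vec; []; _∷_; lookup; toList)
open import Data.Vec.Properties using (∷-injective)
open import Data.Vec.Relation.Unary.AllPairs using (allPairs?)
open import Data.Vec.Relation.Unary.Unique.Propositional using (Unique)
open import Function.Bundles using (_⇔_; mk⇔)
open import Level using (0ℓ)
open import Relation.Binary.Core using (Rel)
import Relation.Binary.Definitions as Binary
open import Relation.Binary.PropositionalEquality.Core using (_≡_; refl)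
open import Relation.Nullary.Decidable using (¬?; _×-dec_; _⊎-dec_)
import Relation.Unary as Unary

words : ∀ {A : Set} → List A → (n : ℕ) → List (Vec A n)
words as zero    = [ [] ]
words as (suc n) = cartesianProductWith _∷_ as (words as n)

-- The pairs (ρᵢ , ρᵢ₊₁) for 1 ≤ i ≤ n - 1, in order (zip truncates).
adjacentPairs : ∀ {A : Set} {n} → Vec A n → List (A × A)
adjacentPairs ρ = zip (toList ρ) (drop 1 (toList ρ))

countAdjacent : ∀ {A : Set} {R : Rel A 0ℓ} → Binary.Decidable R →
                ∀ {n} → Vec A n → ℕ
countAdjacent R? ρ = length (filter (uncurry R?) (adjacentPairs ρ))

lev des asc levOrDes : ∀ {n} → Vec ℕ n → ℕ
lev      = countAdjacent {R = _≡_} _≟_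
des      = countAdjacent {R = _>_} _>?_
asc      = countAdjacent {R = _<_} _<?_
levOrDes = countAdjacent {R = λ x y → x ≡ y ⊎ x > y}
                         (λ x y → (x ≟ y) ⊎-dec (x >? y))

-- The mathematical index of position i : Fin n is suc (toℕ i).
IsInversionSequence : ∀ {n} → Vec ℕ n → Set
IsInversionSequence ρ = ∀ i → 1 ≤ lookup ρ i × lookup ρ i ≤ suc (toℕ i)

isInversionSequence? : ∀ {n} → Unary.Decidable (IsInversionSequence {n})
isInversionSequence? ρ =
  Fin.all? λ i → (1 ≤? lookup ρ i) ×-dec (lookup ρ i ≤? suc (toℕ i))

inversionSequences : (n : ℕ) → List (Vec ℕ n)
inversionSequences n = filter isInversionSequence? (words (map suc (upTo n)) n)

countInversionSequences : ∀ n {P : Vec ℕ n → Set} → Unary.Decidable P → ℕ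
countInversionSequences n P? = length (filter P? (inversionSequences n))

-- One-line notation: a word of length n with distinct letters from an
-- n-element alphabet.
IsPermutation : ∀ {n} → Vec (Fin n) n → Set
IsPermutation π = Unique π

isPermutation? : ∀ {n} → Unary.Decidable (IsPermutation {n})
isPermutation? = allPairs? λ i j → ¬? (i Fin.≟ j)

permutations : (n : ℕ) → List (Vec (Fin n) n)
permutations n = filter isPermutation? (words (allFin n) n)

-- j = πᵐ(i) for some m; since orbits have at most n elements, the exponents
-- 0 ≤ m < n suffice.
SameCycle : ∀ {n} → Vec (Fin n) n → Rel (Fin n) 0ℓ
SameCycle {n} π i j = ∃ λ (m : Fin n) → iterate (lookup π) i (toℕ m) ≡ j

sameCycle? : ∀ {n} (π : Vec (Fin n) n) → Binary.Decidable (SameCycle π)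
sameCycle? π i j = Fin.any? λ m → iterate (lookup π) i (toℕ m) Fin.≟ j

-- The number of classes of SameCycle π: deduplicate keeps exactly one
-- representative of each class.
cycles : ∀ {n} → Vec (Fin n) n → ℕ
cycles {n} π = length (deduplicate (sameCycle? π) (allFin n))

-- Signless Stirling numbers of the first kind.
c : ℕ → ℕ → ℕ
c n k = length (filter (λ π → cycles π ≟ k) (permutations n))

-- Eulerian numbers.
e : ℕ → ℕ → ℕ
e n k = length (filter (λ π → asc (Vec.map toℕ π) ≟ k) (permutations n))

module _ {a ℓ} (R : CommutativeSemiring a ℓ) where
  open CommutativeSemiring R using (Carrier; _+_; _*_; 0#; semiring)
  open Algebra.Properties.Semiring.Exp semiring using (_^_)
  open Algebra.Properties.Semiring.Mult semiring using () renaming (_×_ to _·_)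
  open Algebra.Properties.Semiring.Sum semiring using (sum-syntax)

  -- bₙ(1; p, q, r)
  b : ℕ → Carrier → Carrier → Carrier → Carrier
  b n p q r = foldr _+_ 0# (map weight (inversionSequences n))
    where
    weight : Vec ℕ n → Carrier
    weight ρ = p ^ lev ρ * q ^ des ρ * r ^ asc ρ

  -- f(0) + f(1) t + ⋯ + f(n - 1) tⁿ⁻¹; _·_ is the ℕ-action on R.
  polynomial : ℕ → (ℕ → ℕ) → Carrier → Carrier
  polynomial n f t = ∑[ k < n ] (f (toℕ k) · t ^ toℕ k)

∈-words : ∀ {A : Set} {as : List A} {n} (w : Vec A n) →
          (∀ i → lookup w i ∈ as) → w ∈ words as n
∈-words []      _  = here refl
∈-words (x ∷ w) ∈as =
  ∈-cartesianProductWith⁺ _∷_ (∈as zero) (∈-words w λ i → ∈as (suc i))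

words-unique : ∀ {A : Set} {as : List A} → List.Unique as →
               ∀ n → List.Unique (words as n)
words-unique as! zero    = ListAll.[] ListAllPairs.∷ ListAllPairs.[]
words-unique as! (suc n) =
  ListUnique.cartesianProductWith⁺ _∷_ ∷-injective as! (words-unique as! n)

∈-inversionSequences : ∀ {n} {ρ : Vec ℕ n} →
                       ρ ∈ inversionSequences n ⇔ IsInversionSequence ρ
∈-inversionSequences {n} {ρ} = mk⇔
  (λ ρ∈ → proj₂ (∈-filter⁻ isInversionSequence? {xs = words (map suc (upTo n)) n} ρ∈))
  (λ inv → ∈-filter⁺ isInversionSequence? (∈-words ρ λ i → letter (inv i) (Fin.toℕ<n i)) inv)
  where
  letter : ∀ {x i} → 1 ≤ x × x ≤ suc i → i < n → x ∈ map suc (upTo n)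
  letter (s≤s _ , x≤) i<n = ∈-map⁺ suc (∈-upTo⁺ (≤-trans x≤ i<n))

inversionSequences-unique : ∀ n → List.Unique (inversionSequences n)
inversionSequences-unique n = ListUnique.filter⁺ isInversionSequence?
  (words-unique (ListUnique.map⁺ suc-injective (ListUnique.upTo⁺ n)) n)

∈-permutations : ∀ {n} {π : Vec (Fin n) n} → π ∈ permutations n ⇔ IsPermutation π
∈-permutations {n} {π} = mk⇔
  (λ π∈ → proj₂ (∈-filter⁻ isPermutation? {xs = words (allFin n) n} π∈))
  (λ π! → ∈-filter⁺ isPermutation? (∈-words π λ i → ∈-allFin (lookup π i)) π!)

permutations-unique : ∀ n → List.Unique (permutations n)
permutations-unique n = ListUnique.filter⁺ isPermutation?
  (words-unique (ListUnique.allFin⁺ n) n)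

{-# OPTIONS --safe #-}

-- Both halves compare how a statistic evolves when an object of size n is
-- extended to size n + 1.  Appending a letter to an inversion sequence creates
-- a level for exactly one of the n + 1 choices; inserting a new point into a
-- permutation creates a cycle for exactly one of n + 1 positions.
--
-- For the Eulerian half, record also one boundary letter.  Appending y to an
-- inversion sequence ending in x adds a level or descent iff y ≤ x; putting j
-- in front of a permutation with first letter f (and relabelling the letters
-- ≥ j) adds an ascent iff j ≤ f.  So (last letter, levels + descents) and
-- (first letter, ascents) are generated by the same rule, and (last letter,
-- ascents) follows it too after complementing the last letter.
module Submission where

open import Defs
open import Algebra.Bundles using (CommutativeSemiring)
import Algebra.Properties.CommutativeMonoid.Sum
import Algebra.Properties.Monoid.Mult
import Algebra.Properties.Semiring.Exp
open import Data.Bool.Base using (true; false; if_then_else_)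
open import Data.Fin.Base using (Fin; zero; suc; toℕ; fromℕ; fromℕ<; inject₁; punchIn; punchOut)
import Data.Fin.Properties as Fin
open import Data.Fin.Relation.Unary.Top using (view; ‵fromℕ; ‵inject₁)
open import Data.List.Base using (List; []; _∷_; [_]; map; foldr; filter; length; upTo; allFin; applyUpTo; applyDownFrom; downFrom; replicate; tabulate; concatMap; cartesianProductWith; deduplicate; reverse)
open import Data.List.Membership.Propositional using (_∈_)
open import Data.List.Membership.Propositional.Properties using (∈-map⁺; ∈-map⁻; ∈-upTo⁺; ∈-upTo⁻; ∈-allFin; ∈-cartesianProductWith⁺; ∈-cartesianProductWith⁻)
open import Data.List.Membership.Propositional.Properties.WithK using (unique∧set⇒bag)
import Data.List.Properties as List
open import Data.List.Relation.Binary.BagAndSetEquality using (∼bag⇒↭)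
open import Data.List.Relation.Binary.Permutation.Propositional using (_↭_; refl; prep; swap; trans; ↭-refl; ↭-sym; ↭-trans; ↭-reflexive; module PermutationReasoning)
import Data.List.Relation.Binary.Permutation.Propositional.Properties as ↭
open import Data.List.Relation.Unary.All as All using (All; []; _∷_)
import Data.List.Relation.Unary.All.Properties as All
open import Data.List.Relation.Unary.AllPairs using ([]; _∷_)
open import Data.List.Relation.Unary.Any as Any using (Any; here; there)
import Data.List.Relation.Unary.Unique.Propositional as List
import Data.List.Relation.Unary.Unique.Propositional.Properties as ListUnique
open import Data.Nat.Base using (ℕ; zero; suc; _+_; _∸_; _≤_; _<_; _>_; z≤n; s≤s)
open import Data.Nat.GeneralisedArithmetic using (iterate)
open import Data.Nat.Properties using (_≟_; _≤?_; _<?_; _>?_; ≤-refl; ≤-trans; ≤-reflexive; <-irrefl; <-≤-trans; m≤n⇒m≤1+n; ≰⇒>; ≤∧≢⇒<; ≮⇒≥; ≤-antisym; m<m+n; n<1+n; <⇒≤; <⇒≢; ∸-monoʳ-≤; +-∸-assoc; +-identityʳ; +-comm; +-assoc; +-suc; m+[n∸m]≡n; +-monoˡ-<; suc-injective)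
open import Data.Product.Base using (_×_; _,_; proj₂; ∃; ∃₂; uncurry)
open import Data.Sum.Base using (_⊎_; inj₁; inj₂; [_,_]′)
open import Data.Vec.Base as Vec using (Vec; []; _∷_; _∷ʳ_; last; initLast; lookup)
import Data.Vec.Properties as Vec
import Data.Vec.Relation.Unary.All as VecAll
import Data.Vec.Relation.Unary.All.Properties as VecAll
import Data.Vec.Relation.Unary.AllPairs as VecAllPairs
open import Data.Vec.Relation.Unary.Unique.Propositional using (Unique)
import Data.Vec.Relation.Unary.Unique.Propositional.Properties as VecUnique
open import Function.Base using (_∘_; id)
open import Function.Bundles using (_⇔_; mk⇔; Equivalence)
open import Level using (0ℓ)
open import Relation.Binary.Construct.Closure.ReflexiveTransitive using (Star; ε; _◅_; _◅◅_; kleisliStar)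
open import Relation.Binary.Core using (Rel)
import Relation.Binary.Definitions as Binary
open import Relation.Binary.PropositionalEquality using (_≡_; _≢_; refl; sym; cong; cong₂; subst; module ≡-Reasoning) renaming (trans to ≡-trans)
open import Relation.Nullary using (Dec; yes; no; does; ¬_; contradiction)
open import Relation.Nullary.Decidable using (¬?; _⊎-dec_; dec-true; dec-false)
import Relation.Unary as Unary

open Equivalence using (to; from)

private
  variable
    A B C : Set

𝟙 : ∀ {P : Set} → Dec P → ℕ
𝟙 P? = if does P? then 1 else 0

𝟙-cong : ∀ {P Q : Set} (P? : Dec P) (Q? : Dec Q) → P ⇔ Q → 𝟙 P? ≡ 𝟙 Q?
𝟙-cong (yes _) (yes _) _   = refl
𝟙-cong (no _)  (no _)  _   = refl
𝟙-cong (yes p) (no ¬q) P⇔Q = contradiction (to P⇔Q p) ¬q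
𝟙-cong (no ¬p) (yes q) P⇔Q = contradiction (from P⇔Q q) ¬p

-- Counting in lists

module _ {P : Unary.Pred A 0ℓ} (P? : Unary.Decidable P) where

  length-filter-∷ : ∀ x xs → length (filter P? (x ∷ xs)) ≡ 𝟙 (P? x) + length (filter P? xs)
  length-filter-∷ x xs with does (P? x)
  ... | true  = refl
  ... | false = refl

  filter-map : ∀ (f : B → A) xs → filter P? (map f xs) ≡ map f (filter (P? ∘ f) xs)
  filter-map f []       = refl
  filter-map f (x ∷ xs) with does (P? (f x))
  ... | true  = cong (f x ∷_) (filter-map f xs)
  ... | false = filter-map f xs

  length-filter-map : ∀ (f : B → A) xs → length (filter P? (map f xs)) ≡ length (filter (P? ∘ f) xs)
  length-filter-map f xs =
    ≡-trans (cong length (filter-map f xs)) (List.length-map f (filter (P? ∘ f) xs))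

module _ {P Q : Unary.Pred A 0ℓ} (P? : Unary.Decidable P) (Q? : Unary.Decidable Q) where

  filter-filter-⊆ : (∀ {x} → P x → Q x) → ∀ xs → filter P? (filter Q? xs) ≡ filter P? xs
  filter-filter-⊆ P⊆Q []       = refl
  filter-filter-⊆ P⊆Q (x ∷ xs) with Q? x
  ... | no ¬q = ≡-trans (filter-filter-⊆ P⊆Q xs) (sym (List.filter-reject P? (¬q ∘ P⊆Q)))
  ... | yes _ with does (P? x)
  ...   | true  = cong (x ∷_) (filter-filter-⊆ P⊆Q xs)
  ...   | false = filter-filter-⊆ P⊆Q xs

  length-filter-⊎ : (∀ {x} → P x → ¬ Q x) → ∀ xs →
    length (filter P? xs) + length (filter Q? xs) ≡ length (filter (λ x → P? x ⊎-dec Q? x) xs)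
  length-filter-⊎ disjoint []       = refl
  length-filter-⊎ disjoint (x ∷ xs) with P? x | Q? x
  ... | yes p | yes q = contradiction q (disjoint p)
  ... | yes _ | no _  = cong suc (length-filter-⊎ disjoint xs)
  ... | no _  | yes _ = ≡-trans (+-suc _ _) (cong suc (length-filter-⊎ disjoint xs))
  ... | no _  | no _  = length-filter-⊎ disjoint xs

length-filter-∁ : ∀ {P : Unary.Pred A 0ℓ} (P? : Unary.Decidable P) xs →
  length (filter P? xs) + length (filter (¬? ∘ P?) xs) ≡ length xs
length-filter-∁ P? []       = refl
length-filter-∁ P? (x ∷ xs) with does (P? x)
... | true  = cong suc (length-filter-∁ P? xs)
... | false = ≡-trans (+-suc _ _) (cong suc (length-filter-∁ P? xs))

-- Distributions are compared as lists of values up to order, so statistics on different kinds of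
-- objects can be matched without a bijection between the objects. Here such a match becomes an
-- equality of counts.
count-↭ : ∀ {f : A → ℕ} {g : B → ℕ} {xs ys} → map f xs ↭ map g ys →
  ∀ k → length (filter (λ x → f x ≟ k) xs) ≡ length (filter (λ y → g y ≟ k) ys)
count-↭ {f = f} {g} {xs} {ys} fxs↭gys k = begin
  length (filter (λ x → f x ≟ k) xs)  ≡⟨ length-filter-map (_≟ k) f xs ⟨
  length (filter (_≟ k) (map f xs))   ≡⟨ ↭.↭-length (↭.filter-↭ (_≟ k) fxs↭gys) ⟩
  length (filter (_≟ k) (map g ys))   ≡⟨ length-filter-map (_≟ k) g ys ⟩
  length (filter (λ y → g y ≟ k) ys)  ∎
  where open ≡-Reasoning

-- Generating trees

-- Without repetitions membership has at most one proof, so equal membership already means equal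
-- multiplicities.
unique∧set⇒↭ : ∀ {xs ys : List A} → List.Unique xs → List.Unique ys →
  (∀ {x} → x ∈ xs ⇔ x ∈ ys) → xs ↭ ys
unique∧set⇒↭ xs! ys! xs⇔ys = ∼bag⇒↭ (unique∧set⇒bag xs! ys! xs⇔ys)

concatMap-↭ : ∀ (f : A → List B) {xs ys} → xs ↭ ys → concatMap f xs ↭ concatMap f ys
concatMap-↭ f refl         = ↭-refl
concatMap-↭ f (prep x p)   = ↭.++⁺ˡ (f x) (concatMap-↭ f p)
concatMap-↭ f (swap x y p) =
  ↭-trans (↭.shifts (f x) (f y)) (↭.++⁺ˡ (f y) (↭.++⁺ˡ (f x) (concatMap-↭ f p)))
concatMap-↭ f (trans p q)  = ↭-trans (concatMap-↭ f p) (concatMap-↭ f q)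

module _ {D E : Set} (f : A → B → C) (ys : List B) (g : A → D) (h : C → E) (step : D → List E) where

  map-cartesianProductWith : ∀ xs → (∀ {x} → x ∈ xs → map (h ∘ f x) ys ↭ step (g x)) →
    map h (cartesianProductWith f xs ys) ↭ concatMap step (map g xs)
  map-cartesianProductWith []       _    = ↭-refl
  map-cartesianProductWith (x ∷ xs) rule = ↭-trans
    (↭-reflexive (List.map-++ h (map (f x) ys) (cartesianProductWith f xs ys)))
    (↭.++⁺ (↭-trans (↭-reflexive (sym (List.map-∘ ys))) (rule (here refl)))
           (map-cartesianProductWith xs (rule ∘ there)))

  -- One generation of a generating tree: `zs` are the children of `xs`, one for each choice in
  -- `ys`. The labels of the children depend on the parent only through its own label, so the
  -- recursion can be run on labels alone.
  map-generation : ∀ {xs zs ws} → zs ↭ cartesianProductWith f xs ys →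
    (∀ {x} → x ∈ xs → map (h ∘ f x) ys ↭ step (g x)) →
    map g xs ↭ ws → map h zs ↭ concatMap step ws
  map-generation {xs} {zs} {ws} zs↭ rule gxs↭ws = begin
    map h zs                              ↭⟨ ↭.map⁺ h zs↭ ⟩
    map h (cartesianProductWith f xs ys)  ↭⟨ map-cartesianProductWith xs rule ⟩
    concatMap step (map g xs)             ↭⟨ concatMap-↭ step gxs↭ws ⟩
    concatMap step ws                     ∎
    where open PermutationReasoning

-- Alphabets and the reference distributions

letters : ℕ → List ℕ
letters n = map suc (upTo n)

∈-letters : ∀ {n x} → x ∈ letters n ⇔ (1 ≤ x × x ≤ n)
∈-letters {n} = mk⇔ to′ from′
  where
  to′ : ∀ {x} → x ∈ letters n → 1 ≤ x × x ≤ n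
  to′ x∈ with _ , i∈ , refl ← ∈-map⁻ suc x∈ = s≤s z≤n , ∈-upTo⁻ i∈
  from′ : ∀ {x} → 1 ≤ x × x ≤ n → x ∈ letters n
  from′ (s≤s _ , x≤n) = ∈-map⁺ suc (∈-upTo⁺ x≤n)

letters-unique : ∀ n → List.Unique (letters n)
letters-unique n = ListUnique.map⁺ suc-injective (ListUnique.upTo⁺ n)

length-letters : ∀ n → length (letters n) ≡ n
length-letters n = ≡-trans (List.length-map suc (upTo n)) (List.length-upTo n)

-- Complementation lists the alphabet backwards.
letters-complement : ∀ n → map (suc n ∸_) (letters n) ↭ letters n
letters-complement n = begin
  map (suc n ∸_) (letters n)      ≡⟨ List.map-∘ (upTo n) ⟨
  map (n ∸_) (upTo n)             ≡⟨ List.map-upTo (n ∸_) n ⟩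
  applyUpTo (n ∸_) n              ≡⟨ reversed n ⟩
  applyDownFrom suc n             ≡⟨ List.map-downFrom suc n ⟨
  map suc (downFrom n)            ≡⟨ cong (map suc) (List.reverse-upTo n) ⟨
  map suc (reverse (upTo n))      ↭⟨ ↭.map⁺ suc (↭.↭-reverse (upTo n)) ⟩
  letters n                       ∎
  where
  open PermutationReasoning
  reversed : ∀ n → applyUpTo (n ∸_) n ≡ applyDownFrom suc n
  reversed zero    = refl
  reversed (suc n) = cong (suc n ∷_) (reversed n)

map-toℕ-allFin : ∀ n → map (suc ∘ toℕ) (allFin n) ≡ letters n
map-toℕ-allFin n = ≡-trans (List.map-tabulate id (suc ∘ toℕ))
  (≡-trans (tabulate-toℕ suc n) (sym (List.map-upTo suc n)))
  where
  tabulate-toℕ : ∀ (f : ℕ → ℕ) n → tabulate {n = n} (f ∘ toℕ) ≡ applyUpTo f n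
  tabulate-toℕ f zero    = refl
  tabulate-toℕ f (suc n) = cong (f 0 ∷_) (tabulate-toℕ (f ∘ suc) n)

-- The exponents, with multiplicity, of (t + 1)(t + 2)...(t + n), where `k` occurs c(n + 1, k + 1)
-- times. Index `n` belongs to objects of size n + 1.
stirling : ℕ → List ℕ
stirling zero    = [ 0 ]
stirling (suc n) = concatMap (λ a → suc a ∷ replicate (suc n) a) (stirling n)

-- Pairs (boundary letter , statistic).
eulerianStep : ℕ → ℕ × ℕ → List (ℕ × ℕ)
eulerianStep n (x , a) = map (λ y → y , a + 𝟙 (y ≤? x)) (letters (suc n))

-- Index `n` belongs to size n + 1, as a boundary letter needs a nonempty object. The seed is the
-- only object of size 1.
eulerian : ℕ → List (ℕ × ℕ)
eulerian zero    = [ (1 , 0) ]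
eulerian (suc n) = concatMap (eulerianStep (suc n)) (eulerian n)

-- Adjacent pairs

module _ {R : Rel A 0ℓ} (R? : Binary.Decidable R) where

  countAdjacent-∷ : ∀ {n} x y (v : Vec A n) →
    countAdjacent R? (x ∷ y ∷ v) ≡ 𝟙 (R? x y) + countAdjacent R? (y ∷ v)
  countAdjacent-∷ x y v = length-filter-∷ (uncurry R?) (x , y) (adjacentPairs (y ∷ v))

  -- The only new adjacent pair joins the old last letter to `y`.
  countAdjacent-∷ʳ : ∀ {n} (v : Vec A (suc n)) y →
    countAdjacent R? (v ∷ʳ y) ≡ countAdjacent R? v + 𝟙 (R? (last v) y)
  countAdjacent-∷ʳ (x ∷ [])     y = ≡-trans (countAdjacent-∷ x y []) (+-identityʳ _)
  countAdjacent-∷ʳ (x ∷ z ∷ v) y = begin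
    countAdjacent R? (x ∷ z ∷ (v ∷ʳ y))
      ≡⟨ countAdjacent-∷ x z (v ∷ʳ y) ⟩
    𝟙 (R? x z) + countAdjacent R? (z ∷ (v ∷ʳ y))
      ≡⟨ cong (𝟙 (R? x z) +_) (countAdjacent-∷ʳ (z ∷ v) y) ⟩
    𝟙 (R? x z) + (countAdjacent R? (z ∷ v) + 𝟙 (R? (last (z ∷ v)) y))
      ≡⟨ +-assoc (𝟙 (R? x z)) _ _ ⟨
    𝟙 (R? x z) + countAdjacent R? (z ∷ v) + 𝟙 (R? (last (z ∷ v)) y)
      ≡⟨ cong (_+ 𝟙 (R? (last (z ∷ v)) y)) (countAdjacent-∷ x z v) ⟨
    countAdjacent R? (x ∷ z ∷ v) + 𝟙 (R? (last (x ∷ z ∷ v)) y) ∎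
    where open ≡-Reasoning

  -- There is one adjacent pair fewer than there are letters. The bound keeps every exponent within
  -- the range of `polynomial`.
  countAdjacent-< : ∀ {n} (v : Vec A (suc n)) → countAdjacent R? v < suc n
  countAdjacent-< (x ∷ [])    = ≤-refl
  countAdjacent-< (x ∷ y ∷ v) with does (R? x y)
  ... | true  = s≤s (countAdjacent-< (y ∷ v))
  ... | false = m≤n⇒m≤1+n (countAdjacent-< (y ∷ v))

  countAdjacent-map : ∀ {S : Rel B 0ℓ} (S? : Binary.Decidable S) (f : B → A) →
    (∀ x y → R (f x) (f y) ⇔ S x y) →
    ∀ {n} (v : Vec B n) → countAdjacent R? (Vec.map f v) ≡ countAdjacent S? v
  countAdjacent-map S? f R⇔S []          = refl
  countAdjacent-map S? f R⇔S (x ∷ [])    = refl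
  countAdjacent-map {S = S} S? f R⇔S (x ∷ y ∷ v) = begin
    countAdjacent R? (f x ∷ f y ∷ Vec.map f v)
      ≡⟨ countAdjacent-∷ (f x) (f y) (Vec.map f v) ⟩
    𝟙 (R? (f x) (f y)) + countAdjacent R? (f y ∷ Vec.map f v)
      ≡⟨ cong₂ _+_ (𝟙-cong (R? (f x) (f y)) (S? x y) (R⇔S x y)) (countAdjacent-map S? f R⇔S (y ∷ v)) ⟩
    𝟙 (S? x y) + countAdjacent S? (y ∷ v)
      ≡⟨ length-filter-∷ (uncurry S?) (x , y) (adjacentPairs (y ∷ v)) ⟨
    countAdjacent S? (x ∷ y ∷ v) ∎
    where open ≡-Reasoning

-- No index is both a level and a descent; this later merges two powers of t into one.
lev+des≡levOrDes : ∀ {n} (ρ : Vec ℕ n) → lev ρ + des ρ ≡ levOrDes ρ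
lev+des≡levOrDes ρ = length-filter-⊎ (uncurry _≟_) (uncurry _>?_)
  (λ x≡y x>y → <⇒≢ x>y (sym x≡y)) (adjacentPairs ρ)

-- Inversion sequences

lookup-∷ʳ-inject₁ : ∀ {n} (v : Vec A n) y i → lookup (v ∷ʳ y) (inject₁ i) ≡ lookup v i
lookup-∷ʳ-inject₁ (x ∷ v) y zero    = refl
lookup-∷ʳ-inject₁ (x ∷ v) y (suc i) = lookup-∷ʳ-inject₁ v y i

lookup-∷ʳ-fromℕ : ∀ {n} (v : Vec A n) y → lookup (v ∷ʳ y) (fromℕ n) ≡ y
lookup-∷ʳ-fromℕ []      y = refl
lookup-∷ʳ-fromℕ (x ∷ v) y = lookup-∷ʳ-fromℕ v y

module _ {n : ℕ} (ρ : Vec ℕ n) (y : ℕ) where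

  -- The bound at a position depends only on its index from the left. Growing at the right end keeps
  -- these indices, so the old bounds stay as they are and the new letter gets the bound n + 1.
  isInversionSequence-∷ʳ : IsInversionSequence (ρ ∷ʳ y) ⇔ (IsInversionSequence ρ × y ∈ letters (suc n))
  isInversionSequence-∷ʳ = mk⇔ to′ from′
    where
    to′ : IsInversionSequence (ρ ∷ʳ y) → IsInversionSequence ρ × y ∈ letters (suc n)
    to′ inv = inv-init , from ∈-letters inv-last
      where
      inv-init : IsInversionSequence ρ
      inv-init i with bound ← inv (inject₁ i)
        rewrite lookup-∷ʳ-inject₁ ρ y i | Fin.toℕ-inject₁ i = bound
      inv-last : 1 ≤ y × y ≤ suc n
      inv-last with bound ← inv (fromℕ n)
        rewrite lookup-∷ʳ-fromℕ ρ y | Fin.toℕ-fromℕ n = bound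
    from′ : IsInversionSequence ρ × y ∈ letters (suc n) → IsInversionSequence (ρ ∷ʳ y)
    from′ (inv , y∈) i with view i
    ... | ‵fromℕ     rewrite lookup-∷ʳ-fromℕ ρ y | Fin.toℕ-fromℕ n = to ∈-letters y∈
    ... | ‵inject₁ j rewrite lookup-∷ʳ-inject₁ ρ y j | Fin.toℕ-inject₁ j = inv j

inversionSequences-suc : ∀ n →
  inversionSequences (suc n) ↭ cartesianProductWith _∷ʳ_ (inversionSequences n) (letters (suc n))
inversionSequences-suc n = unique∧set⇒↭ (inversionSequences-unique (suc n))
  (ListUnique.cartesianProductWith⁺ _∷ʳ_ (Vec.∷ʳ-injective _ _) (inversionSequences-unique n) (letters-unique (suc n)))
  (mk⇔ to′ from′)
  where
  to′ : ∀ {ρ} → ρ ∈ inversionSequences (suc n) →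
    ρ ∈ cartesianProductWith _∷ʳ_ (inversionSequences n) (letters (suc n))
  to′ {ρ} ρ∈ with σ , y , refl ← initLast ρ
    with inv , y∈ ← to (isInversionSequence-∷ʳ σ y) (to ∈-inversionSequences ρ∈)
    = ∈-cartesianProductWith⁺ _∷ʳ_ (from ∈-inversionSequences inv) y∈
  from′ : ∀ {ρ} → ρ ∈ cartesianProductWith _∷ʳ_ (inversionSequences n) (letters (suc n)) →
    ρ ∈ inversionSequences (suc n)
  from′ ρ∈ with σ , y , σ∈ , y∈ , refl ← ∈-cartesianProductWith⁻ _∷ʳ_ (inversionSequences n) (letters (suc n)) ρ∈
    = from ∈-inversionSequences (from (isInversionSequence-∷ʳ σ y) (to ∈-inversionSequences σ∈ , y∈))

last∈letters : ∀ {n} {ρ : Vec ℕ (suc n)} → ρ ∈ inversionSequences (suc n) → last ρ ∈ letters (suc n)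
last∈letters {ρ = ρ} ρ∈ with σ , y , refl ← initLast ρ =
  proj₂ (to (isInversionSequence-∷ʳ σ y) (to ∈-inversionSequences ρ∈))

-- In a list without repetitions `x` is met exactly once; that entry is moved to the front to match
-- the step of `stirling`.
map-𝟙≟ : ∀ a {x m} ys → List.Unique ys → x ∈ ys → length ys ≡ suc m →
  map (λ y → a + 𝟙 (x ≟ y)) ys ↭ suc a ∷ replicate m a
map-𝟙≟ a {x} (x ∷ ys) (x∉ ∷ _) (here refl) refl
  rewrite dec-true (x ≟ x) refl | +-comm a 1 = prep (suc a) (↭-reflexive (constant ys x∉))
  where
  constant : ∀ ys → All (x ≢_) ys → map (λ y → a + 𝟙 (x ≟ y)) ys ≡ replicate (length ys) a
  constant []       []          = refl
  constant (y ∷ ys) (x≢y ∷ x∉) rewrite dec-false (x ≟ y) x≢y | +-identityʳ a =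
    cong (a ∷_) (constant ys x∉)
-- `x ∈ ys` forces `ys` to be nonempty; splitting it exposes the head of `replicate` for the final
-- swap.
map-𝟙≟ a {x} (y ∷ ys@(_ ∷ _)) (y∉ ∷ ys!) (there x∈) refl
  rewrite dec-false (x ≟ y) (All.lookup y∉ x∈ ∘ sym) | +-identityʳ a =
  ↭-trans (prep a (map-𝟙≟ a ys ys! x∈ refl)) (swap a (suc a) ↭-refl)

lev-distribution : ∀ n → map lev (inversionSequences (suc n)) ↭ stirling n
lev-distribution zero    = ↭-refl
lev-distribution (suc n) = map-generation _∷ʳ_ (letters (2 + n)) lev lev _
  (inversionSequences-suc (suc n)) rule (lev-distribution n)
  where
  rule : ∀ {ρ} → ρ ∈ inversionSequences (suc n) →
    map (λ y → lev (ρ ∷ʳ y)) (letters (2 + n)) ↭ suc (lev ρ) ∷ replicate (suc n) (lev ρ)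
  rule {ρ} ρ∈ = ↭-trans
    (↭-reflexive (List.map-cong (countAdjacent-∷ʳ _≟_ ρ) (letters (2 + n))))
    (map-𝟙≟ (lev ρ) (letters (2 + n)) (letters-unique (2 + n)) last∈ (length-letters (2 + n)))
    where
    -- The alphabet only grows, so repeating the last letter is always among the choices.
    last∈ : last ρ ∈ letters (2 + n)
    last∈ with 1≤ , ≤n ← to ∈-letters (last∈letters ρ∈) = from ∈-letters (1≤ , m≤n⇒m≤1+n ≤n)

levOrDes-distribution : ∀ n →
  map (λ ρ → last ρ , levOrDes ρ) (inversionSequences (suc n)) ↭ eulerian n
levOrDes-distribution zero    = ↭-refl
levOrDes-distribution (suc n) = map-generation _∷ʳ_ (letters (2 + n)) _ _ (eulerianStep (suc n))
  (inversionSequences-suc (suc n)) (λ {ρ} _ → rule ρ) (levOrDes-distribution n)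
  where
  x≥y : ∀ {x y} → (x ≡ y ⊎ x > y) ⇔ y ≤ x
  x≥y {x} {y} = mk⇔ [ ≤-reflexive ∘ sym , <⇒≤ ]′ from′
    where
    from′ : y ≤ x → x ≡ y ⊎ x > y
    from′ y≤x with x ≟ y
    ... | yes x≡y = inj₁ x≡y
    ... | no  x≢y = inj₂ (≤∧≢⇒< y≤x (x≢y ∘ sym))
  rule : ∀ ρ → map (λ y → last (ρ ∷ʳ y) , levOrDes (ρ ∷ʳ y)) (letters (2 + n))
    ↭ eulerianStep (suc n) (last ρ , levOrDes ρ)
  rule ρ = ↭-reflexive (List.map-cong (λ y → cong₂ _,_ (Vec.last-∷ʳ y ρ)
    (≡-trans (countAdjacent-∷ʳ (λ x y → (x ≟ y) ⊎-dec (x >? y)) ρ y)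
             (cong (levOrDes ρ +_) (𝟙-cong ((last ρ ≟ y) ⊎-dec (last ρ >? y)) (y ≤? last ρ) x≥y))))
    (letters (2 + n)))

-- In size n + 1 the complement of a letter x is n + 2 - x. Old and new letters are complemented in
-- alphabets whose sizes differ by one, which turns the strict inequality of an ascent into the weak
-- one of `eulerianStep`.
asc-distribution : ∀ n →
  map (λ ρ → 2 + n ∸ last ρ , asc ρ) (inversionSequences (suc n)) ↭ eulerian n
asc-distribution zero    = ↭-refl
asc-distribution (suc n) = map-generation _∷ʳ_ (letters (2 + n)) _ _ (eulerianStep (suc n))
  (inversionSequences-suc (suc n)) rule (asc-distribution n)
  where
  complement-< : ∀ {x y} → x ≤ 2 + n → x < y ⇔ 3 + n ∸ y ≤ 2 + n ∸ x
  complement-< {x} {y} x≤ = mk⇔ (∸-monoʳ-≤ (3 + n)) from′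
    where
    from′ : 3 + n ∸ y ≤ 2 + n ∸ x → x < y
    -- Since `x ≤ 2 + n`, the subtraction is not truncated and `3 + n ∸ x` is the successor of
    -- `2 + n ∸ x`; `y ≤ x` would then put a number below itself.
    from′ le = ≰⇒> λ y≤x → <-irrefl refl (≤-trans (≤-reflexive (sym (+-∸-assoc 1 x≤)))
      (≤-trans (∸-monoʳ-≤ (3 + n) y≤x) le))
  rule : ∀ {ρ} → ρ ∈ inversionSequences (suc n) →
    map (λ y → 3 + n ∸ last (ρ ∷ʳ y) , asc (ρ ∷ʳ y)) (letters (2 + n))
    ↭ eulerianStep (suc n) (2 + n ∸ last ρ , asc ρ)
  rule {ρ} ρ∈ = begin
    map (λ y → 3 + n ∸ last (ρ ∷ʳ y) , asc (ρ ∷ʳ y)) (letters (2 + n))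
      ≡⟨ List.map-cong (λ y → cong₂ _,_ (cong (3 + n ∸_) (Vec.last-∷ʳ y ρ))
           (≡-trans (countAdjacent-∷ʳ _<?_ ρ y)
             (cong (asc ρ +_) (𝟙-cong (last ρ <? y) (3 + n ∸ y ≤? 2 + n ∸ last ρ)
               (complement-< (m≤n⇒m≤1+n (proj₂ (to ∈-letters (last∈letters ρ∈)))))))))
           (letters (2 + n)) ⟩
    map (g ∘ (3 + n ∸_)) (letters (2 + n))
      ≡⟨ List.map-∘ (letters (2 + n)) ⟩
    map g (map (3 + n ∸_) (letters (2 + n)))
      -- Indexing the children by complemented letters merely reorders them.
      ↭⟨ ↭.map⁺ g (letters-complement (2 + n)) ⟩
    map g (letters (2 + n)) ∎
    where
    open PermutationReasoning
    g : ℕ → ℕ × ℕ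
    g y = y , asc ρ + 𝟙 (y ≤? 2 + n ∸ last ρ)

-- Permutations

unique-map⁻ : ∀ (f : A → B) {n} {v : Vec A n} → Unique (Vec.map f v) → Unique v
unique-map⁻ f {v = []}    VecAllPairs.[]          = VecAllPairs.[]
unique-map⁻ f {v = _ ∷ _} (fx∉ VecAllPairs.∷ fv!) =
  VecAll.map (λ fx≢fy → fx≢fy ∘ cong f) (VecAll.map⁻ fx∉) VecAllPairs.∷ unique-map⁻ f fv!

vec-map-injective : ∀ {f : A → B} → (∀ {x y} → f x ≡ f y → x ≡ y) →
  ∀ {n} {v w : Vec A n} → Vec.map f v ≡ Vec.map f w → v ≡ w
vec-map-injective inj {v = []}    {[]}    _  = refl
vec-map-injective inj {v = _ ∷ _} {_ ∷ _} eq =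
  cong₂ _∷_ (inj (Vec.∷-injectiveˡ eq)) (vec-map-injective inj (Vec.∷-injectiveʳ eq))

-- p j relabels the letters so as to make room for a new first letter j.
module _ {n : ℕ} (p : Fin (suc n) → Fin n → Fin (suc n))
  (p-injective : ∀ j {x y} → p j x ≡ p j y → x ≡ y)
  (p-avoids : ∀ j x → p j x ≢ j)
  (p-onto : ∀ {j y} → j ≢ y → ∃ λ x → p j x ≡ y) where

  extend : ∀ {m} → Vec (Fin n) m → Fin (suc n) → Vec (Fin (suc n)) (suc m)
  extend π j = j ∷ Vec.map (p j) π

  extend-injective : ∀ {m} {π σ : Vec (Fin n) m} {j k} → extend π j ≡ extend σ k → π ≡ σ × j ≡ k
  extend-injective {π = π} {σ} {j} eq with refl ← Vec.∷-injectiveˡ eq =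
    vec-map-injective (p-injective j) (Vec.∷-injectiveʳ eq) , refl

  map-p-onto : ∀ {j m} {v : Vec (Fin (suc n)) m} → VecAll.All (j ≢_) v → ∃ λ π → Vec.map (p j) π ≡ v
  map-p-onto VecAll.[]          = [] , refl
  map-p-onto (j≢y VecAll.∷ j∉v)
    with x , refl ← p-onto j≢y | π , refl ← map-p-onto j∉v = x ∷ π , refl

  extend-unique : ∀ {m} {π : Vec (Fin n) m} j → Unique π → Unique (extend π j)
  extend-unique {π = π} j π! =
    VecAll.map⁺ (VecAll.lookup⁻ λ i → p-avoids j (lookup π i) ∘ sym)
      VecAllPairs.∷ VecUnique.map⁺ (p-injective j) π!

  -- A permutation is determined by its first letter `j` and the rest, which avoids `j` and hence
  -- comes from exactly one relabelled word. The relabelling is left abstract because ascents call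
  -- for `punchIn` and cycles for `splice`.
  permutations-suc : permutations (suc n) ↭ cartesianProductWith extend (permutations n) (allFin (suc n))
  permutations-suc = unique∧set⇒↭ (permutations-unique (suc n))
    (ListUnique.cartesianProductWith⁺ extend extend-injective (permutations-unique n) (ListUnique.allFin⁺ (suc n)))
    (mk⇔ to′ from′)
    where
    to′ : ∀ {σ} → σ ∈ permutations (suc n) → σ ∈ cartesianProductWith extend (permutations n) (allFin (suc n))
    to′ {j ∷ v} σ∈ with j∉v VecAllPairs.∷ v! ← to ∈-permutations σ∈
      with π , refl ← map-p-onto j∉v
      = ∈-cartesianProductWith⁺ extend (from ∈-permutations (unique-map⁻ (p j) v!)) (∈-allFin j)
    from′ : ∀ {σ} → σ ∈ cartesianProductWith extend (permutations n) (allFin (suc n)) → σ ∈ permutations (suc n)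
    from′ σ∈ with π , j , π∈ , _ , refl ← ∈-cartesianProductWith⁻ extend (permutations n) (allFin (suc n)) σ∈
      = from ∈-permutations (extend-unique j (to ∈-permutations π∈))

-- `punchIn j` fixes the letters below `j` and raises the others by one. The successors give the
-- letters counted from 1 that `eulerianStep` compares.
<punchIn : ∀ {n} (j : Fin (suc n)) i → toℕ j < toℕ (punchIn j i) ⇔ suc (toℕ j) ≤ suc (toℕ i)
<punchIn j i = mk⇔ (to′ j i) (from′ j i)
  where
  to′ : ∀ {n} (j : Fin (suc n)) i → toℕ j < toℕ (punchIn j i) → suc (toℕ j) ≤ suc (toℕ i)
  to′ zero    i       _        = s≤s z≤n
  to′ (suc j) (suc i) (s≤s lt) = s≤s (to′ j i lt)
  from′ : ∀ {n} (j : Fin (suc n)) i → suc (toℕ j) ≤ suc (toℕ i) → toℕ j < toℕ (punchIn j i)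
  from′ zero    i       _        = s≤s z≤n
  from′ (suc j) zero    (s≤s ())
  from′ (suc j) (suc i) (s≤s le) = s≤s (from′ j i le)

punchIn-< : ∀ {n} (j : Fin (suc n)) x y → toℕ (punchIn j x) < toℕ (punchIn j y) ⇔ toℕ x < toℕ y
punchIn-< j x y = mk⇔
  (λ lt → ≰⇒> λ y≤x → <-irrefl refl (<-≤-trans lt (Fin.punchIn-mono-≤ j y x y≤x)))
  (λ lt → ≰⇒> λ y≤x → <-irrefl refl (<-≤-trans lt (Fin.punchIn-cancel-≤ j y x y≤x)))

ascents : ∀ {n m} → Vec (Fin n) m → ℕ
ascents π = asc (Vec.map toℕ π)

ascents-distribution : ∀ n →
  map (λ π → suc (toℕ (Vec.head π)) , ascents π) (permutations (suc n)) ↭ eulerian n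
ascents-distribution zero    = ↭-refl
ascents-distribution (suc n) = map-generation _ (allFin (2 + n)) _ _ (eulerianStep (suc n))
  (permutations-suc punchIn (λ j → Fin.punchIn-injective j _ _) Fin.punchInᵢ≢i
    (λ j≢y → punchOut j≢y , Fin.punchIn-punchOut j≢y))
  (λ {π} _ → rule π) (ascents-distribution n)
  where
  ascents-extend : ∀ (π : Vec (Fin (suc n)) (suc n)) j →
    ascents (j ∷ Vec.map (punchIn j) π) ≡ ascents π + 𝟙 (suc (toℕ j) ≤? suc (toℕ (Vec.head π)))
  ascents-extend π@(x ∷ v) j = begin
    ascents (j ∷ Vec.map (punchIn j) π)
      ≡⟨ countAdjacent-∷ _<?_ (toℕ j) (toℕ (punchIn j x)) _ ⟩
    𝟙 (toℕ j <? toℕ (punchIn j x)) + ascents (Vec.map (punchIn j) π)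
      ≡⟨ cong₂ _+_ (𝟙-cong (toℕ j <? _) (suc (toℕ j) ≤? suc (toℕ x)) (<punchIn j x)) relabel ⟩
    𝟙 (suc (toℕ j) ≤? suc (toℕ x)) + ascents π
      ≡⟨ +-comm _ (ascents π) ⟩
    ascents π + 𝟙 (suc (toℕ j) ≤? suc (toℕ x)) ∎
    where
    open ≡-Reasoning
    _<ᶠ?_ : Binary.Decidable (λ (x y : Fin (suc n)) → toℕ x < toℕ y)
    x <ᶠ? y = toℕ x <? toℕ y
    -- `punchIn j` is strictly increasing. Both sides are compared with the count on `π` itself for
    -- the order pulled back along `toℕ`.
    relabel : ascents (Vec.map (punchIn j) π) ≡ ascents π
    relabel = begin
      asc (Vec.map toℕ (Vec.map (punchIn j) π))  ≡⟨ cong asc (Vec.map-∘ toℕ (punchIn j) π) ⟨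
      asc (Vec.map (toℕ ∘ punchIn j) π)          ≡⟨ countAdjacent-map _<?_ _<ᶠ?_ (toℕ ∘ punchIn j) (punchIn-< j) π ⟩
      countAdjacent _<ᶠ?_ π                      ≡⟨ countAdjacent-map _<?_ _<ᶠ?_ toℕ (λ _ _ → mk⇔ id id) π ⟨
      ascents π                                  ∎
  rule : ∀ π → map (λ j → suc (toℕ j) , ascents (j ∷ Vec.map (punchIn j) π)) (allFin (2 + n))
    ↭ eulerianStep (suc n) (suc (toℕ (Vec.head π)) , ascents π)
  rule π = begin
    map (λ j → suc (toℕ j) , ascents (j ∷ Vec.map (punchIn j) π)) (allFin (2 + n))
      ≡⟨ List.map-cong (λ j → cong (suc (toℕ j) ,_) (ascents-extend π j)) (allFin (2 + n)) ⟩
    map (g ∘ suc ∘ toℕ) (allFin (2 + n))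
      ≡⟨ List.map-∘ (allFin (2 + n)) ⟩
    map g (map (suc ∘ toℕ) (allFin (2 + n)))
      ≡⟨ cong (map g) (map-toℕ-allFin (2 + n)) ⟩
    map g (letters (2 + n)) ∎
    where
    open PermutationReasoning
    g : ℕ → ℕ × ℕ
    g y = y , ascents π + 𝟙 (y ≤? suc (toℕ (Vec.head π)))

-- Cycles

module _ {R : Rel A 0ℓ} (R? : Binary.Decidable R) where

  deduplicate-map : ∀ {S : Rel B 0ℓ} (S? : Binary.Decidable S) (f : B → A) →
    (∀ x y → R (f x) (f y) ⇔ S x y) →
    ∀ xs → deduplicate R? (map f xs) ≡ map f (deduplicate S? xs)
  deduplicate-map S? f R⇔S []       = refl
  deduplicate-map S? f R⇔S (x ∷ xs) = cong (f x ∷_) (begin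
    filter (¬? ∘ R? (f x)) (deduplicate R? (map f xs))
      ≡⟨ cong (filter (¬? ∘ R? (f x))) (deduplicate-map S? f R⇔S xs) ⟩
    filter (¬? ∘ R? (f x)) (map f (deduplicate S? xs))
      ≡⟨ filter-map (¬? ∘ R? (f x)) f (deduplicate S? xs) ⟩
    map f (filter (¬? ∘ R? (f x) ∘ f) (deduplicate S? xs))
      ≡⟨ cong (map f) (List.filter-≐ (¬? ∘ R? (f x) ∘ f) (¬? ∘ S? x)
           ((λ ¬r → ¬r ∘ from (R⇔S x _)) , (λ ¬s → ¬s ∘ to (R⇔S x _))) (deduplicate S? xs)) ⟩
    map f (filter (¬? ∘ S? x) (deduplicate S? xs)) ∎)
    where open ≡-Reasoning

  module _ (R-sym : Binary.Symmetric R) (R-trans : Binary.Transitive R) where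

    -- If the head `y` is related to `x`, it is kept and everything left is unrelated to `y`, hence
    -- to `x`. Otherwise removing the relatives of `y` touches no relative of `x`.
    one-representative : ∀ {x} xs → Any (R x) xs → length (filter (R? x) (deduplicate R? xs)) ≡ 1
    one-representative {x} (y ∷ ys) x∈ with R? x y
    ... | yes Rxy = cong (suc ∘ length) (List.filter-none (R? x)
      (All.map (λ ¬Ryz Rxz → ¬Ryz (R-trans (R-sym Rxy) Rxz)) (All.all-filter (¬? ∘ R? y) (deduplicate R? ys))))
    ... | no ¬Rxy = ≡-trans
      (cong length (filter-filter-⊆ (R? x) (¬? ∘ R? y)
        (λ Rxz Ryz → ¬Rxy (R-trans Rxz (R-sym Ryz))) (deduplicate R? ys)))
      (one-representative ys (Any.tail ¬Rxy x∈))

    -- The new head replaces the single representative of its class.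
    length-deduplicate-∷ : ∀ {x} xs → Any (R x) xs →
      length (deduplicate R? (x ∷ xs)) ≡ length (deduplicate R? xs)
    length-deduplicate-∷ {x} xs x∈ = ≡-trans
      (cong (_+ length (filter (¬? ∘ R? x) (deduplicate R? xs))) (sym (one-representative xs x∈)))
      (length-filter-∁ (R? x) (deduplicate R? xs))

-- Orbits of a map on a finite set

<⇒∃+suc : ∀ {m n} → m < n → ∃ λ d → m + suc d ≡ n
<⇒∃+suc {m} {n} m<n = n ∸ suc m , ≡-trans (+-suc m _) (m+[n∸m]≡n m<n)

iterate-+ : ∀ (f : A → A) x m k → iterate f x (m + k) ≡ iterate f (iterate f x m) k
iterate-+ f x zero    k = refl
iterate-+ f x (suc m) k = iterate-+ f (f x) m k

iterate-injective : ∀ {f : A → A} → (∀ {x y} → f x ≡ f y → x ≡ y) →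
  ∀ m {x y} → iterate f x m ≡ iterate f y m → x ≡ y
iterate-injective inj zero    eq = eq
iterate-injective inj (suc m) eq = inj (iterate-injective inj m eq)

-- `SameCycle` bounds its exponent by n, which composing paths would break. Here paths have any
-- length; `reach⇒iterate` restores the bound.
Reach : (A → A) → Rel A 0ℓ
Reach f = Star (λ x y → f x ≡ y)

iterate⇒reach : ∀ (f : A → A) x m → Reach f x (iterate f x m)
iterate⇒reach f x zero    = ε
iterate⇒reach f x (suc m) = refl ◅ iterate⇒reach f (f x) m

module _ {n : ℕ} (f : Fin n → Fin n) where

  -- Pigeonhole on the n + 1 iterates with exponents 0 to n.
  iterate-collision : ∀ x → ∃₂ λ i d → i + suc d ≤ n × iterate f x i ≡ iterate f x (i + suc d)
  iterate-collision x
    with i , j , i<j , eq ← Fin.pigeonhole (n<1+n n) (iterate f x ∘ toℕ {suc n})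
    with d , i+1+d≡j ← <⇒∃+suc i<j
    = toℕ i , d , subst (_≤ n) (sym i+1+d≡j) (Fin.toℕ≤pred[n] j) , ≡-trans eq (cong (iterate f x) (sym i+1+d≡j))

  -- The loop of length `suc d` given by the collision is cut out of the n steps.
  iterate-shorten : ∀ x → ∃ λ k → k < n × iterate f x k ≡ iterate f x n
  iterate-shorten x with i , d , i+1+d≤n , eq ← iterate-collision x =
    i + (n ∸ (i + suc d)) , lt , (begin
      iterate f x (i + (n ∸ (i + suc d)))              ≡⟨ iterate-+ f x i _ ⟩
      iterate f (iterate f x i) (n ∸ (i + suc d))      ≡⟨ cong (λ y → iterate f y (n ∸ (i + suc d))) eq ⟩
      iterate f (iterate f x (i + suc d)) (n ∸ (i + suc d)) ≡⟨ iterate-+ f x (i + suc d) _ ⟨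
      iterate f x (i + suc d + (n ∸ (i + suc d)))      ≡⟨ cong (iterate f x) (m+[n∸m]≡n i+1+d≤n) ⟩
      iterate f x n                                    ∎)
    where
    open ≡-Reasoning
    lt : i + (n ∸ (i + suc d)) < n
    lt = <-≤-trans (+-monoˡ-< _ (m<m+n i (s≤s z≤n))) (≤-reflexive (m+[n∸m]≡n i+1+d≤n))

  -- Prefixing a step to a bounded path exceeds the bound only when the length becomes exactly n,
  -- and then it can be shortened.
  reach⇒iterate : ∀ {x y} → Reach f x y → ∃ λ m → m < n × iterate f x m ≡ y
  reach⇒iterate {x} ε = 0 , ≤-trans (s≤s z≤n) (Fin.toℕ<n x) , refl
  reach⇒iterate {x} (refl ◅ r) with k , k<n , eq ← reach⇒iterate r with suc k <? n
  ... | yes 1+k<n = suc k , 1+k<n , eq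
  ... | no  1+k≮n with l , l<n , eq′ ← iterate-shorten x =
    l , l<n , ≡-trans eq′ (≡-trans (cong (iterate f x) (≤-antisym (≮⇒≥ 1+k≮n) k<n)) eq)

  -- Each step can be undone: cancelling the first `i` applications of the injective `f` in a
  -- collision shows that `x` returns to itself after `suc d` steps, hence is reached from `f x` in
  -- `d`.
  reach-sym : (∀ {x y} → f x ≡ f y → x ≡ y) → Binary.Symmetric (Reach f)
  reach-sym inj ε          = ε
  reach-sym inj {x} (refl ◅ r) = reach-sym inj r ◅◅ back
    where
    back : Reach f (f x) x
    back with i , d , _ , eq ← iterate-collision x =
      subst (Reach f (f x)) (sym (iterate-injective inj i (≡-trans eq
        (≡-trans (cong (iterate f x) (+-comm i (suc d))) (iterate-+ f x (suc d) i)))))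
        (iterate⇒reach f (f x) d)

sameCycle⇔reach : ∀ {n} (π : Vec (Fin n) n) {x y} → SameCycle π x y ⇔ Reach (lookup π) x y
sameCycle⇔reach π {x} = mk⇔
  (λ { (m , eq) → subst (Reach (lookup π) x) eq (iterate⇒reach (lookup π) x (toℕ m)) })
  (λ r → let k , k<n , eq = reach⇒iterate (lookup π) r in
    fromℕ< k<n , ≡-trans (cong (iterate (lookup π) x) (Fin.toℕ-fromℕ< k<n)) eq)

module _ {n : ℕ} {π : Vec (Fin n) n} (π! : Unique π) where

  sameCycle-sym : Binary.Symmetric (SameCycle π)
  sameCycle-sym = from (sameCycle⇔reach π)
    ∘ reach-sym (lookup π) (VecUnique.lookup-injective π! _ _) ∘ to (sameCycle⇔reach π)

  sameCycle-trans : Binary.Transitive (SameCycle π)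
  sameCycle-trans r s = from (sameCycle⇔reach π) (to (sameCycle⇔reach π) r ◅◅ to (sameCycle⇔reach π) s)

-- suc followed by the transposition (0 j).  Hence j ∷ map (splice j) π fixes 0
-- if j = 0, and otherwise is π (shifted by suc) with 0 inserted right before j.
splice : ∀ {n} → Fin (suc n) → Fin n → Fin (suc n)
splice zero    x = suc x
splice (suc i) x = if does (x Fin.≟ i) then zero else suc x

splice-≡ : ∀ {n} (i : Fin n) → splice (suc i) i ≡ zero
splice-≡ i rewrite dec-true (i Fin.≟ i) refl = refl

splice-≢ : ∀ {n} {i x : Fin n} → x ≢ i → splice (suc i) x ≡ suc x
splice-≢ {i = i} {x} x≢i rewrite dec-false (x Fin.≟ i) x≢i = refl

splice-injective : ∀ {n} (j : Fin (suc n)) {x y} → splice j x ≡ splice j y → x ≡ y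
splice-injective zero    refl = refl
splice-injective (suc i) {x} {y} eq with x Fin.≟ i | y Fin.≟ i | eq
... | yes x≡i | yes y≡i | _    = ≡-trans x≡i (sym y≡i)
... | no _    | no _    | refl = refl

splice-avoids : ∀ {n} (j : Fin (suc n)) x → splice j x ≢ j
splice-avoids zero    x ()
splice-avoids (suc i) x eq with x Fin.≟ i | eq
... | no x≢i | refl = x≢i refl

splice-onto : ∀ {n} {j y : Fin (suc n)} → j ≢ y → ∃ λ x → splice j x ≡ y
splice-onto {j = zero}  {zero}  0≢0 = contradiction refl 0≢0
splice-onto {j = zero}  {suc y} _   = y , refl
splice-onto {j = suc i} {zero}  _   = i , splice-≡ i
splice-onto {j = suc i} {suc y} j≢y = y , splice-≢ (λ y≡i → j≢y (cong suc (sym y≡i)))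

-- Cycles after inserting a point

module _ {n : ℕ} (π : Vec (Fin n) n) where

  private
    σ : Fin (suc n) → Vec (Fin (suc n)) (suc n)
    σ j = j ∷ Vec.map (splice j) π

    lookup-σ : ∀ j x → lookup (σ j) (suc x) ≡ splice j (lookup π x)
    lookup-σ j x = Vec.lookup-map x (splice j) π

  -- A step of `π` lifts to a single step, except that a step into the point `i`, for `j = suc i`,
  -- makes a detour through 0.
  reach-splice⁺ : ∀ j {x y} → Reach (lookup π) x y → Reach (lookup (σ j)) (suc x) (suc y)
  reach-splice⁺ j ε          = ε
  reach-splice⁺ j {x} (refl ◅ r) = step j ◅◅ reach-splice⁺ j r
    where
    step : ∀ j → Reach (lookup (σ j)) (suc x) (suc (lookup π x))
    step zero = lookup-σ zero x ◅ ε
    step (suc i) with lookup π x Fin.≟ i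
    ... | yes refl = ≡-trans (lookup-σ (suc i) x) (splice-≡ i) ◅ refl ◅ ε
    ... | no πx≢i  = ≡-trans (lookup-σ (suc i) x) (splice-≢ πx≢i) ◅ ε

  -- Contracting 0 to the point it was inserted before turns each step of σ
  -- into at most one step of π.
  contract : Fin n → Fin (suc n) → Fin n
  contract i zero    = i
  contract i (suc x) = x

  reach-contract : ∀ i {x y} → Reach (lookup (σ (suc i))) x y → Reach (lookup π) (contract i x) (contract i y)
  reach-contract i = kleisliStar (contract i) (λ { {x} refl → step x })
    where
    step : ∀ x → Reach (lookup π) (contract i x) (contract i (lookup (σ (suc i)) x))
    step zero    = ε
    step (suc x) rewrite lookup-σ (suc i) x with lookup π x Fin.≟ i
    ... | yes πx≡i = πx≡i ◅ ε
    ... | no _     = refl ◅ ε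

  reach-zero : ∀ {y} → Reach (lookup (σ zero)) zero y → y ≡ zero
  reach-zero ε          = refl
  reach-zero (refl ◅ r) = reach-zero r

  -- With `j = zero` there is no point to contract 0 to, but a path that starts at a successor never
  -- visits 0.
  reach-suc : ∀ {x y} → Reach (lookup (σ zero)) (suc x) (suc y) → Reach (lookup π) x y
  reach-suc ε = ε
  reach-suc {x} (refl ◅ r) rewrite lookup-σ zero x = refl ◅ reach-suc r

  reach-splice⁻ : ∀ j {x y} → Reach (lookup (σ j)) (suc x) (suc y) → Reach (lookup π) x y
  reach-splice⁻ zero    = reach-suc
  reach-splice⁻ (suc i) = reach-contract i

  -- Detours through 0 change the exponents, so the comparison goes through `Reach`.
  sameCycle-splice : ∀ j x y → SameCycle (σ j) (suc x) (suc y) ⇔ SameCycle π x y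
  sameCycle-splice j x y = mk⇔
    (from (sameCycle⇔reach π) ∘ reach-splice⁻ j ∘ to (sameCycle⇔reach (σ j)))
    (from (sameCycle⇔reach (σ j)) ∘ reach-splice⁺ j ∘ to (sameCycle⇔reach π))

  private
    allFin-suc : allFin (suc n) ≡ zero ∷ map suc (allFin n)
    allFin-suc = cong (zero ∷_) (sym (List.map-tabulate id suc))

    representatives : ∀ j → deduplicate (sameCycle? (σ j)) (map suc (allFin n))
      ≡ map suc (deduplicate (sameCycle? π) (allFin n))
    representatives j = deduplicate-map (sameCycle? (σ j)) (sameCycle? π) suc (sameCycle-splice j) (allFin n)

    length-representatives : ∀ j → length (deduplicate (sameCycle? (σ j)) (map suc (allFin n))) ≡ cycles π
    length-representatives j = ≡-trans (cong length (representatives j))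
      (List.length-map suc (deduplicate (sameCycle? π) (allFin n)))

  -- 0 is a class of its own, so it removes no other representative.
  cycles-fixed : cycles (zero ∷ Vec.map suc π) ≡ suc (cycles π)
  cycles-fixed = begin
    length (deduplicate R? (allFin (suc n)))
      ≡⟨ cong (length ∘ deduplicate R?) allFin-suc ⟩
    suc (length (filter (¬? ∘ R? zero) (deduplicate R? (map suc (allFin n)))))
      ≡⟨ cong (suc ∘ length) (List.filter-all (¬? ∘ R? zero) isolated) ⟩
    suc (length (deduplicate R? (map suc (allFin n))))
      ≡⟨ cong suc (length-representatives zero) ⟩
    suc (cycles π) ∎
    where
    open ≡-Reasoning
    R? = sameCycle? (σ zero)
    isolated : All (λ y → ¬ SameCycle (σ zero) zero y) (deduplicate R? (map suc (allFin n)))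
    isolated rewrite representatives zero = All.map⁺ (All.universal
      (λ y r → Fin.0≢1+n (sym (reach-zero (to (sameCycle⇔reach (σ zero)) r)))) _)

  -- 0 is sent to `suc i` and so joins an existing class.
  cycles-inserted : Unique π → ∀ i → cycles (suc i ∷ Vec.map (splice (suc i)) π) ≡ cycles π
  cycles-inserted π! i = begin
    length (deduplicate R? (allFin (suc n)))
      ≡⟨ cong (length ∘ deduplicate R?) allFin-suc ⟩
    length (deduplicate R? (zero ∷ map suc (allFin n)))
      ≡⟨ length-deduplicate-∷ R? (sameCycle-sym σ!) (sameCycle-trans σ!) (map suc (allFin n)) zero∼ ⟩
    length (deduplicate R? (map suc (allFin n)))
      ≡⟨ length-representatives (suc i) ⟩
    cycles π ∎
    where
    open ≡-Reasoning
    R? = sameCycle? (σ (suc i))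
    σ! : Unique (σ (suc i))
    σ! = extend-unique splice splice-injective splice-avoids splice-onto (suc i) π!
    zero∼ : Any (SameCycle (σ (suc i)) zero) (map suc (allFin n))
    zero∼ = Any.map (λ { refl → from (sameCycle⇔reach (σ (suc i))) (refl ◅ ε) }) (∈-map⁺ suc (∈-allFin i))

-- The offset comes from size 1, with one cycle but no level. It persists because `step` commutes
-- with adding 1.
cycles-distribution : ∀ n → map cycles (permutations (suc n)) ↭ map suc (stirling n)
cycles-distribution zero    = ↭-refl
cycles-distribution (suc n) = ↭-trans
  (map-generation _ (allFin (2 + n)) cycles cycles step
    (permutations-suc splice splice-injective splice-avoids splice-onto) rule (cycles-distribution n))
  (↭-reflexive shift)
  where
  step : ℕ → List ℕ
  step a = suc a ∷ replicate (suc n) a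
  rule : ∀ {π} → π ∈ permutations (suc n) →
    map (λ j → cycles (j ∷ Vec.map (splice j) π)) (allFin (2 + n)) ↭ step (cycles π)
  rule {π} π∈ = ↭-reflexive (cong₂ _∷_ (cycles-fixed π) (begin
    map (λ j → cycles (j ∷ Vec.map (splice j) π)) (tabulate suc)
      ≡⟨ List.map-tabulate suc _ ⟩
    tabulate (λ i → cycles (suc i ∷ Vec.map (splice (suc i)) π))
      ≡⟨ List.tabulate-cong (cycles-inserted π (to ∈-permutations π∈)) ⟩
    tabulate (λ (_ : Fin (suc n)) → cycles π)
      ≡⟨ tabulate-const (suc n) ⟩
    replicate (suc n) (cycles π) ∎))
    where
    open ≡-Reasoning
    tabulate-const : ∀ m {a : ℕ} → tabulate {n = m} (λ _ → a) ≡ replicate m a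
    tabulate-const zero    = refl
    tabulate-const (suc m) = cong (_ ∷_) (tabulate-const m)
  shift : concatMap step (map suc (stirling n)) ≡ map suc (concatMap step (stirling n))
  shift = begin
    concatMap step (map suc (stirling n))        ≡⟨ List.concatMap-map step suc (stirling n) ⟩
    concatMap (step ∘ suc) (stirling n)          ≡⟨ List.concatMap-cong (λ a → cong (suc (suc a) ∷_) (sym (List.map-replicate suc (suc n) a))) (stirling n) ⟩
    concatMap (map suc ∘ step) (stirling n)      ≡⟨ List.map-concatMap suc step (stirling n) ⟨
    map suc (concatMap step (stirling n))        ∎
    where open ≡-Reasoning

-- Generating polynomials

module _ {a ℓ} (R : CommutativeSemiring a ℓ) where
  open CommutativeSemiring R using (Carrier; _≈_; 0#; 1#; semiring; setoid; +-commutativeMonoid; +-monoid; +-cong;  *-congʳ; *-congˡ; *-cong; *-identityʳ; *-identityˡ)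
    renaming (+-identityˡ to ⊕-identityˡ; +-identityʳ to ⊕-identityʳ; _+_ to _⊕_; _*_ to _⊛_; refl to ≈-refl; sym to ≈-sym; trans to ≈-trans)
  open Algebra.Properties.Semiring.Exp semiring using (_^_; ^-homo-*; ^-congʳ)
  open Algebra.Properties.Monoid.Mult +-monoid using (×-homo-1; ×-homo-+; ×-congˡ) renaming (_×_ to _·_)
  open Algebra.Properties.CommutativeMonoid.Sum +-commutativeMonoid using (sum-syntax; sum-cong-≋; sum-replicate-zero; ∑-distrib-+)

  polynomial-cong : ∀ n {f g : ℕ → ℕ} t → (∀ k → f k ≡ g k) → polynomial R n f t ≈ polynomial R n g t
  polynomial-cong n t f≗g = sum-cong-≋ {n} (λ k → ×-congˡ (f≗g (toℕ k)))

  sum-𝟙≟ : ∀ {n x} (g : ℕ → Carrier) → x < n → ∑[ k < n ] (𝟙 (x ≟ toℕ k) · g (toℕ k)) ≈ g x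
  sum-𝟙≟ {suc n} {zero}  g _         =
    ≈-trans (+-cong (×-homo-1 (g 0)) (sum-replicate-zero n)) (⊕-identityʳ (g 0))
  sum-𝟙≟ {suc n} {suc x} g (s≤s x<n) =
    ≈-trans (⊕-identityˡ _) (sum-𝟙≟ (g ∘ suc) x<n)

  -- Each weight is expanded as a sum over all exponents below n, with an indicator as coefficient;
  -- adding up the indicators for one exponent gives the count.
  sum-by-value : ∀ {X : Set} n t (f : X → ℕ) (w : X → Carrier) →
    (∀ x → f x < n) → (∀ x → w x ≈ t ^ f x) → ∀ xs →
    foldr _⊕_ 0# (map w xs) ≈ polynomial R n (λ k → length (filter (λ x → f x ≟ k) xs)) t
  sum-by-value n t f w f<n w≈ []       = ≈-sym (sum-replicate-zero n)
  sum-by-value n t f w f<n w≈ (x ∷ xs) = begin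
    w x ⊕ foldr _⊕_ 0# (map w xs)
      ≈⟨ +-cong (≈-trans (w≈ x) (≈-sym (sum-𝟙≟ (t ^_) (f<n x)))) (sum-by-value n t f w f<n w≈ xs) ⟩
    ∑[ k < n ] (𝟙 (f x ≟ toℕ k) · t ^ toℕ k) ⊕ ∑[ k < n ] (count (toℕ k) xs · t ^ toℕ k)
      ≈⟨ ∑-distrib-+ {n} _ _ ⟨
    ∑[ k < n ] (𝟙 (f x ≟ toℕ k) · t ^ toℕ k ⊕ count (toℕ k) xs · t ^ toℕ k)
      ≈⟨ sum-cong-≋ {n} (λ k → ≈-trans (≈-sym (×-homo-+ (t ^ toℕ k) (𝟙 (f x ≟ toℕ k)) (count (toℕ k) xs)))
           (×-congˡ (sym (length-filter-∷ (λ y → f y ≟ toℕ k) x xs)))) ⟩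
    polynomial R n (λ k → count k (x ∷ xs)) t ∎
    where
    open import Relation.Binary.Reasoning.Setoid setoid
    count : ℕ → List _ → ℕ
    count k ys = length (filter (λ y → f y ≟ k) ys)

  1^n≈1 : ∀ n → 1# ^ n ≈ 1#
  1^n≈1 zero    = ≈-refl
  1^n≈1 (suc n) = ≈-trans (*-identityˡ _) (1^n≈1 n)

  module _ (n : ℕ) (t : Carrier) where
    open import Relation.Binary.Reasoning.Setoid setoid

    b-lev : b R (suc n) t 1# 1# ≈ polynomial R (suc n) (λ k → countInversionSequences (suc n) (λ ρ → lev ρ ≟ k)) t
    b-lev = sum-by-value (suc n) t lev _ (countAdjacent-< _≟_) (λ ρ → begin
      t ^ lev ρ ⊛ 1# ^ des ρ ⊛ 1# ^ asc ρ  ≈⟨ *-cong (*-congˡ (1^n≈1 (des ρ))) (1^n≈1 (asc ρ)) ⟩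
      t ^ lev ρ ⊛ 1# ⊛ 1#                  ≈⟨ ≈-trans (*-identityʳ _) (*-identityʳ _) ⟩
      t ^ lev ρ                            ∎) (inversionSequences (suc n))

    b-asc : b R (suc n) 1# 1# t ≈ polynomial R (suc n) (λ k → countInversionSequences (suc n) (λ ρ → asc ρ ≟ k)) t
    b-asc = sum-by-value (suc n) t asc _ (countAdjacent-< _<?_) (λ ρ → begin
      1# ^ lev ρ ⊛ 1# ^ des ρ ⊛ t ^ asc ρ  ≈⟨ *-congʳ (*-cong (1^n≈1 (lev ρ)) (1^n≈1 (des ρ))) ⟩
      1# ⊛ 1# ⊛ t ^ asc ρ                  ≈⟨ ≈-trans (*-congʳ (*-identityˡ 1#)) (*-identityˡ _) ⟩
      t ^ asc ρ                            ∎) (inversionSequences (suc n))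

    b-levOrDes : b R (suc n) t t 1# ≈ polynomial R (suc n) (λ k → countInversionSequences (suc n) (λ ρ → levOrDes ρ ≟ k)) t
    b-levOrDes = sum-by-value (suc n) t levOrDes _
      (countAdjacent-< (λ x y → (x ≟ y) ⊎-dec (x >? y))) (λ ρ → begin
      t ^ lev ρ ⊛ t ^ des ρ ⊛ 1# ^ asc ρ  ≈⟨ *-congˡ (1^n≈1 (asc ρ)) ⟩
      t ^ lev ρ ⊛ t ^ des ρ ⊛ 1#          ≈⟨ *-identityʳ _ ⟩
      t ^ lev ρ ⊛ t ^ des ρ               ≈⟨ ^-homo-* t (lev ρ) (des ρ) ⟨
      t ^ (lev ρ + des ρ)                 ≈⟨ ^-congʳ t (lev+des≡levOrDes ρ) ⟩
      t ^ levOrDes ρ                      ∎) (inversionSequences (suc n))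

-- Equidistribution

count-lev : ∀ n k → countInversionSequences (suc n) (λ ρ → lev ρ ≟ k) ≡ c (suc n) (suc k)
count-lev n k = ≡-trans
  -- Levels are shifted by one so that both sides count the value `suc k`.
  (cong length (List.filter-≐ (λ ρ → lev ρ ≟ k) (λ ρ → suc (lev ρ) ≟ suc k)
    (cong suc , suc-injective) (inversionSequences (suc n))))
  (count-↭ (begin
    map (suc ∘ lev) (inversionSequences (suc n))      ≡⟨ List.map-∘ (inversionSequences (suc n)) ⟩
    map suc (map lev (inversionSequences (suc n)))    ↭⟨ ↭.map⁺ suc (lev-distribution n) ⟩
    map suc (stirling n)                              ↭⟨ cycles-distribution n ⟨
    map cycles (permutations (suc n))                 ∎) (suc k))
  where open PermutationReasoning

-- The boundary letter was carried only to make the recursion close; it is now forgotten.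
second-marginal : ∀ {l s : A → ℕ} {l′ s′ : B → ℕ} {xs ys zs} →
  map (λ x → l x , s x) xs ↭ zs → map (λ y → l′ y , s′ y) ys ↭ zs → map s xs ↭ map s′ ys
second-marginal {xs = xs} {ys} p q = ↭-trans (↭-reflexive (List.map-∘ xs))
  (↭-trans (↭.map⁺ proj₂ (↭-trans p (↭-sym q))) (↭-reflexive (sym (List.map-∘ ys))))

count-asc : ∀ n k → countInversionSequences (suc n) (λ ρ → asc ρ ≟ k) ≡ e (suc n) k
count-asc n = count-↭ (second-marginal (asc-distribution n) (ascents-distribution n))

count-levOrDes : ∀ n k → countInversionSequences (suc n) (λ ρ → levOrDes ρ ≟ k) ≡ e (suc n) k
count-levOrDes n = count-↭ (second-marginal (levOrDes-distribution n) (ascents-distribution n))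

theorem3p5 : ∀ {a ℓ} (R : CommutativeSemiring a ℓ) → let open CommutativeSemiring R in
    (n : ℕ) → 1 ≤ n →
    ((t : Carrier) → b R n t 1# 1# ≈ polynomial R n (λ k → c n (suc k)) t)
    × ((t : Carrier) → (b R n 1# 1# t ≈ b R n t t 1#) × (b R n t t 1# ≈ polynomial R n (λ k → e n k) t))
    × ((k : ℕ) → countInversionSequences n (λ ρ → lev ρ ≟ k) ≡ c n (suc k))
    × ((k : ℕ) → countInversionSequences n (λ ρ → asc ρ ≟ k) ≡ e n k)
    × ((k : ℕ) → countInversionSequences n (λ ρ → levOrDes ρ ≟ k) ≡ e n k)
theorem3p5 R (suc n) _ =
    (λ t → ≈-trans (b-lev R n t) (polynomial-cong R (suc n) t (count-lev n)))
  , (λ t → ≈-trans (asc-polynomial t) (≈-sym (levOrDes-polynomial t)) , levOrDes-polynomial t)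
  , count-lev n
  , count-asc n
  , count-levOrDes n
  where
  open CommutativeSemiring R using (Carrier; _≈_; 1#) renaming (sym to ≈-sym; trans to ≈-trans)
  asc-polynomial : ∀ t → b R (suc n) 1# 1# t ≈ polynomial R (suc n) (e (suc n)) t
  asc-polynomial t = ≈-trans (b-asc R n t) (polynomial-cong R (suc n) t (count-asc n))
  levOrDes-polynomial : ∀ t → b R (suc n) t t 1# ≈ polynomial R (suc n) (e (suc n)) t
  levOrDes-polynomial t = ≈-trans (b-levOrDes R n t) (polynomial-cong R (suc n) t (count-levOrDes n))
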